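{- Let $G$ be a uniquely $C_4^{+}$-saturated graph on $n$ vertices with $k\geq 2$ triangles, let $A$ be the set of all vertices of $G$ that lie in some triangle of $G$, and let $t=\min\{k-|N_G(u)\cap A| : u\in N(A)\}$. Then $n\leq \frac{1}{2}k^{2}+\frac{10t+5}{2}k+\frac{25t^{2}+7t}{2}+1$.
   Context: All graphs are finite, simple and undirected. $C_4^{+}$ (the diamond) is the graph obtained from a $4$-cycle by adding one chord, i.e. $K_4$ minus an edge. For a graph $H$, a graph $G$ is uniquely $H$-saturated if $G$ contains no subgraph isomorphic to $H$, but for every pair of non-adjacent vertices $u,v$ of $G$, the graph $G+uv$ contains exactly one subgraph isomorphic to $H$. A triangle is a subgraph isomorphic to $K_3$. $N_G(u)$ is the neighborhood of $u$. For $U\subseteq V(G)$, $N(U)$ is the set of vertices not in $U$ having a neighbor in $U$ (vertices at distance exactly $1$ from $U$). -}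

module Defs where

open import Data.Nat using (ℕ; zero; suc; _+_; _<ᵇ_)
open import Data.Bool using (Bool; true; false; _∧_; _∨_; not; if_then_else_)
open import Data.Fin using (Fin; toℕ; _≟_)
open import Data.List using (List; []; _∷_; [_]; map; concatMap; allFin; length; filterᵇ)
open import Data.Bool.ListAction using (and; or)
open import Data.Nat.ListAction using (sum)
open import Data.Vec.Functional using () renaming (_∷_ to _∷ᶠ_)
open import Data.Product using (Σ; _×_; _,_)
open import Relation.Nullary using (¬_; does)
open import Relation.Binary.PropositionalEquality using (_≡_)

Adj : ℕ → Set
Adj n = Fin n → Fin n → Bool

SimpleGraph : ∀ {n} → Adj n → Set
SimpleGraph {n} G = (∀ (u v : Fin n) → G u v ≡ G v u) × (∀ (u : Fin n) → G u u ≡ false)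

_==_ : ∀ {n} → Fin n → Fin n → Bool
a == b = does (a ≟ b)

addEdge : ∀ {n} → Adj n → Fin n → Fin n → Adj n
addEdge G u v x y = G x y ∨ ((x == u ∧ y == v) ∨ (x == v ∧ y == u))

funs : (m n : ℕ) → List (Fin m → Fin n)
funs zero n = [ (λ ()) ]
funs (suc m) n = concatMap (λ x → map (λ f → x ∷ᶠ f) (funs m n)) (allFin n)

isEmb : ∀ {m n} → Adj m → Adj n → (Fin m → Fin n) → Bool
isEmb {m} H G f =
  and (concatMap (λ i → map (λ j →
      (not (f i == f j) ∨ (i == j)) ∧ (not (H i j) ∨ G (f i) (f j)))
    (allFin m)) (allFin m))

-- number of injective homomorphisms H → G.
-- This equals (number of subgraphs of G isomorphic to H) * |Aut(H)|,
-- and |Aut(H)| = emb H H.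
emb : ∀ {m n} → Adj m → Adj n → ℕ
emb {m} {n} H G = length (filterᵇ (isEmb H G) (funs m n))

-- the diamond C4+ = K4 minus the edge {2,3}; vertices 0,1 form the chord
diamond : Adj 4
diamond a b = not (a == b) ∧ not ((toℕ a + toℕ b) Data.Nat.≡ᵇ 5)
  where import Data.Nat

DiamondFree : ∀ {n} → Adj n → Set
DiamondFree G = emb diamond G ≡ 0

ExactlyOneDiamond : ∀ {n} → Adj n → Set
ExactlyOneDiamond G = emb diamond G ≡ emb diamond diamond

UniquelyDiamondSaturated : ∀ {n} → Adj n → Set
UniquelyDiamondSaturated {n} G =
  DiamondFree G ×
  (∀ (u v : Fin n) → ¬ (u ≡ v) → G u v ≡ false → ExactlyOneDiamond (addEdge G u v))

count : ∀ {A : Set} → (A → Bool) → List A → ℕ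
count p xs = length (filterᵇ p xs)

_<F_ : ∀ {n} → Fin n → Fin n → Bool
a <F b = toℕ a <ᵇ toℕ b

triangles : ∀ {n} → Adj n → ℕ
triangles {n} G =
  sum (map (λ a → sum (map (λ b → count (λ c →
        (a <F b) ∧ (b <F c) ∧ G a b ∧ G a c ∧ G b c) (allFin n)) (allFin n))) (allFin n))

inA : ∀ {n} → Adj n → Fin n → Bool
inA {n} G u = or (concatMap (λ b → map (λ c → G u b ∧ G u c ∧ G b c) (allFin n)) (allFin n))

inNA : ∀ {n} → Adj n → Fin n → Bool
inNA {n} G u = not (inA G u) ∧ or (map (λ v → G u v ∧ inA G v) (allFin n))

degA : ∀ {n} → Adj n → Fin n → ℕ
degA {n} G u = count (λ v → G u v ∧ inA G v) (allFin n)

{-# OPTIONS --safe #-}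
module Submission where

-- For u ≠ v non-adjacent, unique saturation says that either u and v have exactly two common
-- neighbours x and no edge ux, xv lies in a triangle, or they have exactly one and exactly one of
-- ux, xv lies in a triangle. Hence the triangles are disjoint, and everything becomes linear algebra
-- with the adjacency matrix a, its square c, and the matrix e of triangle edges. Let u ∉ A.
-- Evaluating the walks of length 3 between u and a neighbour v from both ends gives
-- deg v = deg u + 2 [v ∈ A], and then the walks of length 2 from u give
-- 2n = deg(u)² + deg u + 4 d + 2 with d = |N(u) ∩ A|. In particular d is the same for adjacent
-- vertices outside A, so when d > 0 each neighbour of u outside A has a neighbour in A; that neighbour
-- lies in a triangle missed by u, and each of the 3(k - d) vertices of those triangles is reached at
-- most twice. So deg u ≤ d + 6 (k - d), which is inserted into the formula for 2n.

open import Defs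
open import Data.Nat using (ℕ; zero; suc; _+_; _∸_; _≤_; z≤n; s≤s)
import Data.Nat as Nat using (_*_)
open import Data.Nat.Properties hiding (_≟_)
open import Data.Nat.Tactic.RingSolver using (solve-∀)
import Data.Nat.ListAction as List
open import Data.Fin using (Fin; zero; suc; _≟_; punchIn) renaming (_<_ to _<ᶠ_)
open import Data.Fin.Patterns using (0F; 1F; 2F; 3F; 4F)
open import Data.Fin.Properties using (punchInᵢ≢i; any?; injective⇒≤) renaming (<-cmp to <ᶠ-cmp)
open import Data.Bool using (Bool; true; false; T?; _∧_; _∨_; not)
open import Data.Bool.ListAction using (and; or)
open import Data.Bool.Properties using (T-≡; not-¬; ¬-not; ∨-comm; ∧-comm; ∨-zeroʳ) renaming (_≟_ to _≟ᵇ_)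
open import Data.List using (List; []; _∷_; map; concatMap; allFin; tabulate; length; filterᵇ; lookup)
open import Data.List.Properties using (map-tabulate)
open import Data.List.Membership.Propositional using (_∈_; lose)
open import Data.List.Membership.Propositional.Properties using (∈-map⁺; ∈-map⁻; ∈-concatMap⁺; ∈-concatMap⁻; ∈-filter⁺; ∈-filter⁻; ∈-allFin)
open import Data.List.Relation.Unary.Any using (here; there; index; satisfied)
open import Data.List.Relation.Unary.Any.Properties using (lookup-index)
open import Data.Vec using (Vec; []; _∷_)
open import Data.Vec.Functional using (updateAt) renaming (_∷_ to _∷ᶠ_)
open import Data.Vec.Functional.Properties using (updateAt-updates; updateAt-minimal)
open import Algebra.Properties.Semiring.Sum +-*-semiring using (sum-cong-≗; sum-remove; ∑-distrib-+; ∑-comm; *-distribˡ-sum; *-distribʳ-sum) renaming (sum to ∑)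
open import Data.Product using (Σ; ∃; ∃₂; _×_; _,_; proj₁; proj₂)
open import Data.Sum using (_⊎_; inj₁; inj₂)
open import Data.Empty using (⊥; ⊥-elim)
open import Function using (_∘_; const; Injective)
open import Function.Bundles using (Equivalence)
open import Relation.Nullary using (¬_; Dec; yes; no; contradiction)
open import Relation.Nullary.Decidable using (_×-dec_)
open import Relation.Binary.Definitions using (tri<; tri≈; tri>)
open import Relation.Binary.PropositionalEquality using (_≡_; _≢_; refl; sym; trans; cong; cong₂; subst; subst₂; module ≡-Reasoning)

-- Boolean tests and list membership.

module _ {A B C : Set} {h : A → B → C} {xs : List A} {ys : List B} where

  ∈-pairs⁺ : ∀ {x y} → x ∈ xs → y ∈ ys → h x y ∈ concatMap (λ i → map (h i) ys) xs
  ∈-pairs⁺ x∈ y∈ = ∈-concatMap⁺ (λ i → map (h i) ys) (lose x∈ (∈-map⁺ (h _) y∈))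

  ∈-pairs⁻ : ∀ {z} → z ∈ concatMap (λ i → map (h i) ys) xs → ∃₂ λ x y → z ≡ h x y
  ∈-pairs⁻ z∈ with satisfied (∈-concatMap⁻ (λ i → map (h i) ys) {xs = xs} z∈)
  ... | x , z∈x with ∈-map⁻ (h x) z∈x
  ... | y , _ , eq = x , y , eq

and⁺ : ∀ {bs} → (∀ {b} → b ∈ bs → b ≡ true) → and bs ≡ true
and⁺ {[]}     all = refl
and⁺ {b ∷ bs} all rewrite all (here refl) = and⁺ (all ∘ there)

and⁻ : ∀ {b bs} → and bs ≡ true → b ∈ bs → b ≡ true
and⁻ {bs = true ∷ bs} eq (here refl) = refl
and⁻ {bs = true ∷ bs} eq (there b∈)  = and⁻ eq b∈

or⁺ : ∀ {bs} → true ∈ bs → or bs ≡ true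
or⁺ (here refl)                       = refl
or⁺ {b ∷ _} (there t∈) rewrite or⁺ t∈ = ∨-zeroʳ b

or⁻ : ∀ {bs} → or bs ≡ true → true ∈ bs
or⁻ {true  ∷ bs} eq = here refl
or⁻ {false ∷ bs} eq = there (or⁻ eq)

∧⁻ : ∀ {a b} → a ∧ b ≡ true → a ≡ true × b ≡ true
∧⁻ {true} eq = refl , eq

∧⁺ : ∀ {a b} → a ≡ true → b ≡ true → a ∧ b ≡ true
∧⁺ refl eq = eq

∨⁻ : ∀ {a b} → a ∨ b ≡ true → a ≡ true ⊎ b ≡ true
∨⁻ {true}  eq = inj₁ eq
∨⁻ {false} eq = inj₂ eq

∈-filterᵇ⁺ : ∀ {A : Set} (p : A → Bool) {x xs} → x ∈ xs → p x ≡ true → x ∈ filterᵇ p xs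
∈-filterᵇ⁺ p x∈ px = ∈-filter⁺ (T? ∘ p) x∈ (Equivalence.from T-≡ px)

∈-filterᵇ⁻ : ∀ {A : Set} (p : A → Bool) {x xs} → x ∈ filterᵇ p xs → x ∈ xs × p x ≡ true
∈-filterᵇ⁻ p {xs = xs} x∈ with ∈-filter⁻ (T? ∘ p) {xs = xs} x∈
... | x∈xs , px = x∈xs , Equivalence.to T-≡ px

-- Distinct members sit at distinct positions. Only a lower bound on the length is claimed, so
-- repetitions in the list do no harm.
injective-∈⇒≤-length : ∀ {A : Set} {m} {xs : List A} (f : Fin m → A) →
  Injective _≡_ _≡_ f → (∀ i → f i ∈ xs) → m ≤ length xs
injective-∈⇒≤-length {xs = xs} f f-inj f∈ = injective⇒≤ {f = index ∘ f∈} λ {i} {j} eq →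
  f-inj (trans (lookup-index (f∈ i)) (trans (cong (lookup xs) eq) (sym (lookup-index (f∈ j)))))

-- Embeddings

==⇒≡ : ∀ {n} {x y : Fin n} → x == y ≡ true → x ≡ y
==⇒≡ {x = x} {y} eq with yes p ← x ≟ y = p

≡⇒== : ∀ {n} {x y : Fin n} → x ≡ y → x == y ≡ true
≡⇒== {x = x} {y} eq with x ≟ y
... | yes _ = refl
... | no x≢y = contradiction eq x≢y

implies⁺ : ∀ {a b} → (a ≡ true → b ≡ true) → not a ∨ b ≡ true
implies⁺ {false} f = refl
implies⁺ {true}  f = f refl

implies⁻ : ∀ {a b} → not a ∨ b ≡ true → a ≡ true → b ≡ true
implies⁻ eq refl = eq

module _ {m n} {H : Adj m} {G : Adj n} {f : Fin m → Fin n} where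

  isEmb⁺ : Injective _≡_ _≡_ f → (∀ i j → H i j ≡ true → G (f i) (f j) ≡ true) → isEmb H G f ≡ true
  isEmb⁺ inj hom = and⁺ λ b∈ → let i , j , eq = ∈-pairs⁻ {xs = allFin m} {ys = allFin m} b∈ in
    trans eq (∧⁺ (implies⁺ (≡⇒== ∘ inj ∘ ==⇒≡)) (implies⁺ (hom i j)))

  isEmb⁻ : isEmb H G f ≡ true → ∀ i j → (f i ≡ f j → i ≡ j) × (H i j ≡ true → G (f i) (f j) ≡ true)
  isEmb⁻ eq i j = let p , q = ∧⁻ (and⁻ eq (∈-pairs⁺ (∈-allFin i) (∈-allFin j))) in
    ==⇒≡ ∘ implies⁻ p ∘ ≡⇒== , implies⁻ q

-- The empty function of `funs` is reused because absurd lambdas are not definitionally equal.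
tuple : ∀ {m n} → Vec (Fin n) m → Fin m → Fin n
tuple {n = n} []   = lookup (funs 0 n) 0F
tuple (x ∷ xs)     = x ∷ᶠ tuple xs

tuple∈funs : ∀ {m n} (xs : Vec (Fin n) m) → tuple xs ∈ funs m n
tuple∈funs []       = here refl
tuple∈funs (x ∷ xs) = ∈-pairs⁺ {h = _∷ᶠ_} (∈-allFin x) (tuple∈funs xs)

-- The chord is `a b` and the tips are `c` and `d`, which may be adjacent because copies need not be
-- induced. In a simple graph the five edges already force every other pair of vertices to differ.
record Diamond {n} (G : Adj n) (a b c d : Fin n) : Set where
  constructor mkDiamond
  field
    ab : G a b ≡ true
    ac : G a c ≡ true
    ad : G a d ≡ true
    bc : G b c ≡ true
    bd : G b d ≡ true
    c≢d : c ≢ d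

module Embeddings {n} (G : Adj n) (simple : SimpleGraph G) where

  G-sym : ∀ {x y} → G x y ≡ true → G y x ≡ true
  G-sym {x} {y} = trans (proj₁ simple y x)

  G-irrefl : ∀ {x y} → G x y ≡ true → x ≢ y
  G-irrefl {x} xy refl = not-¬ (proj₂ simple x) xy

  swap-chord : ∀ {a b c d} → Diamond G a b c d → Diamond G b a c d
  swap-chord (mkDiamond ab ac ad bc bd c≢d) = mkDiamond (G-sym ab) bc bd ac ad c≢d

  swap-tips : ∀ {a b c d} → Diamond G a b c d → Diamond G a b d c
  swap-tips (mkDiamond ab ac ad bc bd c≢d) = mkDiamond ab ad ac bd bc (c≢d ∘ sym)

  embeddings : List (Fin 4 → Fin n)
  embeddings = filterᵇ (isEmb diamond G) (funs 4 n)

  Diamond⇒∈ : ∀ {a b c d} → Diamond G a b c d → tuple (a ∷ b ∷ c ∷ d ∷ []) ∈ embeddings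
  Diamond⇒∈ {a} {b} {c} {d} (mkDiamond ab ac ad bc bd c≢d) =
    ∈-filterᵇ⁺ (isEmb diamond G) (tuple∈funs (a ∷ b ∷ c ∷ d ∷ [])) (isEmb⁺ {H = diamond} {G} (λ {i} {j} → inj i j) hom)
    where
    f = tuple (a ∷ b ∷ c ∷ d ∷ [])

    hom : ∀ i j → diamond i j ≡ true → G (f i) (f j) ≡ true
    hom 0F 1F _ = ab
    hom 0F 2F _ = ac
    hom 0F 3F _ = ad
    hom 1F 0F _ = G-sym ab
    hom 1F 2F _ = bc
    hom 1F 3F _ = bd
    hom 2F 0F _ = G-sym ac
    hom 2F 1F _ = G-sym bc
    hom 3F 0F _ = G-sym ad
    hom 3F 1F _ = G-sym bd
    hom 2F 2F ()
    hom 2F 3F ()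
    hom 3F 2F ()
    hom 3F 3F ()

    inj : ∀ i j → f i ≡ f j → i ≡ j
    inj 0F 0F _  = refl
    inj 0F 1F eq = contradiction eq (G-irrefl ab)
    inj 0F 2F eq = contradiction eq (G-irrefl ac)
    inj 0F 3F eq = contradiction eq (G-irrefl ad)
    inj 1F 0F eq = contradiction (sym eq) (G-irrefl ab)
    inj 1F 1F _  = refl
    inj 1F 2F eq = contradiction eq (G-irrefl bc)
    inj 1F 3F eq = contradiction eq (G-irrefl bd)
    inj 2F 0F eq = contradiction (sym eq) (G-irrefl ac)
    inj 2F 1F eq = contradiction (sym eq) (G-irrefl bc)
    inj 2F 2F _  = refl
    inj 2F 3F eq = contradiction eq c≢d
    inj 3F 0F eq = contradiction (sym eq) (G-irrefl ad)
    inj 3F 1F eq = contradiction (sym eq) (G-irrefl bd)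
    inj 3F 2F eq = contradiction (sym eq) c≢d
    inj 3F 3F _  = refl

  ∈⇒Diamond : ∀ {f} → f ∈ embeddings → Diamond G (f 0F) (f 1F) (f 2F) (f 3F)
  ∈⇒Diamond {f} f∈ = mkDiamond (edge 0F 1F refl) (edge 0F 2F refl) (edge 0F 3F refl)
    (edge 1F 2F refl) (edge 1F 3F refl) (λ eq → contradiction (proj₁ (e 2F 3F) eq) λ ())
    where
    e = isEmb⁻ {H = diamond} {G} {f} (proj₂ (∈-filterᵇ⁻ (isEmb diamond G) {xs = funs 4 n} f∈))
    edge : ∀ i j → diamond i j ≡ true → G (f i) (f j) ≡ true
    edge i j = proj₂ (e i j)

  diamond-free : DiamondFree G → ∀ {a b c d} → ¬ Diamond G a b c d
  diamond-free none D with embeddings | none | Diamond⇒∈ D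
  ... | [] | _ | ()

  module _ (one : ExactlyOneDiamond G) where

    diamond-exists : ∃₂ λ a b → ∃₂ λ c d → Diamond G a b c d
    -- `emb diamond diamond` evaluates to 4, so `one` is itself a statement about length 4. The list
    -- is abstracted so that it can be matched on.
    diamond-exists = nonempty embeddings one ∈⇒Diamond
      where
      nonempty : ∀ fs → length fs ≡ 4 →
        (∀ {f} → f ∈ fs → Diamond G (f 0F) (f 1F) (f 2F) (f 3F)) → ∃₂ λ a b → ∃₂ λ c d → Diamond G a b c d
      nonempty (f ∷ _) _ D = _ , _ , _ , _ , D (here refl)

    module _ {a b c d} (D : Diamond G a b c d) {f} (f∈ : f ∈ embeddings) where
      open Diamond D

      private
        fs : Fin 5 → Fin 4 → Fin n
        fs 0F = tuple (a ∷ b ∷ c ∷ d ∷ [])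
        fs 1F = tuple (b ∷ a ∷ c ∷ d ∷ [])
        fs 2F = tuple (a ∷ b ∷ d ∷ c ∷ [])
        fs 3F = tuple (b ∷ a ∷ d ∷ c ∷ [])
        fs 4F = f

        fs∈ : ∀ i → fs i ∈ embeddings
        fs∈ 0F = Diamond⇒∈ D
        fs∈ 1F = Diamond⇒∈ (swap-chord D)
        fs∈ 2F = Diamond⇒∈ (swap-tips D)
        fs∈ 3F = Diamond⇒∈ (swap-chord (swap-tips D))
        fs∈ 4F = f∈

      -- The automorphisms already account for all four embeddings.
      not-new : (∀ i → f ≡ fs i → i ≡ 4F) → ⊥
      not-new new = <⇒≱ (s≤s (≤-reflexive one)) (injective-∈⇒≤-length fs (λ {i} {j} → inj i j) fs∈)
        where
        at : ∀ {g h : Fin 4 → Fin n} i → g ≡ h → g i ≡ h i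
        at i = cong (λ g → g i)
        a≢b = G-irrefl ab
        inj : ∀ i j → fs i ≡ fs j → i ≡ j
        inj 0F 0F _ = refl
        inj 0F 1F eq = contradiction (at 0F eq) a≢b
        inj 0F 2F eq = contradiction (at 2F eq) c≢d
        inj 0F 3F eq = contradiction (at 0F eq) a≢b
        inj 1F 0F eq = contradiction (sym (at 0F eq)) a≢b
        inj 1F 1F _ = refl
        inj 1F 2F eq = contradiction (sym (at 0F eq)) a≢b
        inj 1F 3F eq = contradiction (at 2F eq) c≢d
        inj 2F 0F eq = contradiction (sym (at 2F eq)) c≢d
        inj 2F 1F eq = contradiction (at 0F eq) a≢b
        inj 2F 2F _ = refl
        inj 2F 3F eq = contradiction (at 0F eq) a≢b
        inj 3F 0F eq = contradiction (sym (at 0F eq)) a≢b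
        inj 3F 1F eq = contradiction (sym (at 2F eq)) c≢d
        inj 3F 2F eq = contradiction (sym (at 0F eq)) a≢b
        inj 3F 3F _ = refl
        inj 4F j eq = sym (new j eq)
        inj i 4F eq = new i (sym eq)

    module _ {a b c d} (D : Diamond G a b c d) where

      -- The four embeddings coming from `D` send 0 to `a` or `b`, so a diamond with any other chord
      -- end yields a fifth embedding.
      chord-unique : ∀ {a′ b′ c′ d′} → Diamond G a′ b′ c′ d′ → a′ ≢ a → a′ ≢ b → ⊥
      chord-unique D′ ≢a ≢b = not-new D (Diamond⇒∈ D′) λ where
        0F eq → contradiction (cong (λ g → g 0F) eq) ≢a
        1F eq → contradiction (cong (λ g → g 0F) eq) ≢b
        2F eq → contradiction (cong (λ g → g 0F) eq) ≢a
        3F eq → contradiction (cong (λ g → g 0F) eq) ≢b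
        4F _ → refl

      -- The same argument at position 2, which holds a tip.
      tip-unique : ∀ {a′ b′ c′ d′} → Diamond G a′ b′ c′ d′ → c′ ≢ c → c′ ≢ d → ⊥
      tip-unique D′ ≢c ≢d = not-new D (Diamond⇒∈ D′) λ where
        0F eq → contradiction (cong (λ g → g 2F) eq) ≢c
        1F eq → contradiction (cong (λ g → g 2F) eq) ≢c
        2F eq → contradiction (cong (λ g → g 2F) eq) ≢d
        3F eq → contradiction (cong (λ g → g 2F) eq) ≢d
        4F _ → refl

-- Adding an edge.

SamePair : ∀ {n} → Fin n → Fin n → Fin n → Fin n → Set
SamePair u v x y = (x ≡ u × y ≡ v) ⊎ (x ≡ v × y ≡ u)

module _ {n} (G : Adj n) {u v : Fin n} where

  addEdge⁻ : ∀ {x y} → addEdge G u v x y ≡ true → G x y ≡ true ⊎ SamePair u v x y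
  addEdge⁻ eq with ∨⁻ eq
  ... | inj₁ old = inj₁ old
  ... | inj₂ new with ∨⁻ new
  ... | inj₁ p = let q , r = ∧⁻ p in inj₂ (inj₁ (==⇒≡ q , ==⇒≡ r))
  ... | inj₂ p = let q , r = ∧⁻ p in inj₂ (inj₂ (==⇒≡ q , ==⇒≡ r))

  addEdge-old : ∀ {x y} → G x y ≡ true → addEdge G u v x y ≡ true
  addEdge-old eq rewrite eq = refl

  addEdge-new : addEdge G u v u v ≡ true
  addEdge-new rewrite ≡⇒== {x = u} refl | ≡⇒== {x = v} refl = ∨-zeroʳ (G u v)

  addEdge-simple : SimpleGraph G → u ≢ v → SimpleGraph (addEdge G u v)
  addEdge-simple (G-sym , G-irrefl) u≢v = symm , irrefl
    where
    symm : ∀ x y → addEdge G u v x y ≡ addEdge G u v y x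
    symm x y = cong₂ _∨_ (G-sym x y)
      (trans (∨-comm (x == u ∧ y == v) _) (cong₂ _∨_ (∧-comm (x == v) _) (∧-comm (x == u) _)))
    irrefl : ∀ x → addEdge G u v x x ≡ false
    irrefl x with addEdge G u v x x in eq
    ... | false = refl
    ... | true with addEdge⁻ eq
    ... | inj₁ xx                   = contradiction xx (not-¬ (G-irrefl x))
    ... | inj₂ (inj₁ (refl , x≡v)) = contradiction x≡v u≢v
    ... | inj₂ (inj₂ (refl , x≡u)) = contradiction (sym x≡u) u≢v

-- The diamond created by a non-edge.

module Saturated {n} (G : Adj n) (simple : SimpleGraph G) (saturated : UniquelyDiamondSaturated G) where

  open Embeddings G simple

  Common : Fin n → Fin n → Fin n → Set
  Common u v x = G u x ≡ true × G x v ≡ true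

  TriangleEdge : Fin n → Fin n → Set
  TriangleEdge x y = G x y ≡ true × ∃ (Common x y)

  Common-sym : ∀ {u v x} → Common u v x → Common v u x
  Common-sym (ux , xv) = G-sym xv , G-sym ux

  TriangleEdge-sym : ∀ {x y} → TriangleEdge x y → TriangleEdge y x
  TriangleEdge-sym (xy , s , com) = G-sym xy , s , Common-sym com

  -- Two triangles on one edge form a diamond.
  common-unique : ∀ {x y s t} → G x y ≡ true → Common x y s → Common x y t → s ≡ t
  common-unique {s = s} {t} xy (xs , sy) (xt , ty) with s ≟ t
  ... | yes s≡t = s≡t
  ... | no s≢t  = ⊥-elim (diamond-free (proj₁ saturated)
                    (mkDiamond xy xs xt (G-sym sy) (G-sym ty) s≢t))

  -- The role of the new edge `u v` in the created diamond. In `chord` it is the chord, with tips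
  -- `x` and `y`. In `left` it is a side with chord end `u` and tip `v`: the chord is `u x`, and the
  -- other tip completes the triangle on `u x`. In `right` the roles of `u` and `v` are exchanged.
  data Completion (u v : Fin n) : Set where
    chord : ∀ {x y} → x ≢ y → Common u v x → Common u v y → Completion u v
    left  : ∀ {x} → Common u v x → TriangleEdge u x → Completion u v
    right : ∀ {x} → Common u v x → TriangleEdge x v → Completion u v

  Completion-sym : ∀ {u v} → Completion u v → Completion v u
  Completion-sym (chord x≢y cx cy) = chord x≢y (Common-sym cx) (Common-sym cy)
  Completion-sym (left c e)        = right (Common-sym c) (TriangleEdge-sym e)
  Completion-sym (right c e)       = left (Common-sym c) (TriangleEdge-sym e)

  module NonEdge {u v : Fin n} (u≢v : u ≢ v) (uv : G u v ≡ false) where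

    private
      G⁺ : Adj n
      G⁺ = addEdge G u v

      module E⁺ = Embeddings G⁺ (addEdge-simple G simple u≢v)

      one : ExactlyOneDiamond G⁺
      one = proj₂ saturated u v u≢v uv

      old : ∀ {x y} → G x y ≡ true → G⁺ x y ≡ true
      old = addEdge-old G

      new : G⁺ u v ≡ true
      new = addEdge-new G

      -- The pair `p q` is the new edge in the orientation in which the diamond uses it, so that one
      -- argument serves both orientations.
      still-old : ∀ {p q x y} → SamePair u v p q → G⁺ x y ≡ true →
        ¬ (x ≡ p × y ≡ q) → ¬ (x ≡ q × y ≡ p) → G x y ≡ true
      still-old pq xy ≢₁ ≢₂ with addEdge⁻ G xy | pq
      ... | inj₁ e | _ = e
      ... | inj₂ (inj₁ (refl , refl)) | inj₁ (refl , refl) = contradiction (refl , refl) ≢₁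
      ... | inj₂ (inj₁ (refl , refl)) | inj₂ (refl , refl) = contradiction (refl , refl) ≢₂
      ... | inj₂ (inj₂ (refl , refl)) | inj₁ (refl , refl) = contradiction (refl , refl) ≢₂
      ... | inj₂ (inj₂ (refl , refl)) | inj₂ (refl , refl) = contradiction (refl , refl) ≢₁

      fromPair : ∀ {p q} → SamePair u v p q → Completion p q → Completion u v
      fromPair (inj₁ (refl , refl)) C = C
      fromPair (inj₂ (refl , refl)) C = Completion-sym C

      via-chord : ∀ {a b c d} → Diamond G⁺ a b c d → SamePair u v a b → Completion u v
      via-chord (mkDiamond ab ac ad bc bd c≢d) pq = fromPair pq
        (chord c≢d (o ac (b≢c ∘ sym ∘ proj₂) (a≢c ∘ sym ∘ proj₂) , G-sym (o bc (b≢a ∘ proj₁) (a≢c ∘ sym ∘ proj₂)))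
                   (o ad (b≢d ∘ sym ∘ proj₂) (a≢d ∘ sym ∘ proj₂) , G-sym (o bd (b≢a ∘ proj₁) (a≢d ∘ sym ∘ proj₂))))
        where
        o : ∀ {x y} → G⁺ x y ≡ true → _ → _ → G x y ≡ true
        o = still-old pq
        b≢a = E⁺.G-irrefl ab ∘ sym
        a≢c = E⁺.G-irrefl ac
        a≢d = E⁺.G-irrefl ad
        b≢c = E⁺.G-irrefl bc
        b≢d = E⁺.G-irrefl bd

      via-side : ∀ {a b c d} → Diamond G⁺ a b c d → SamePair u v a c → Completion u v
      via-side (mkDiamond ab ac ad bc bd c≢d) pq = fromPair pq
        (left (ab′ , o bc (b≢a ∘ proj₁) (b≢c ∘ proj₁))
              (ab′ , _ , o ad (c≢d ∘ sym ∘ proj₂) (a≢c ∘ proj₁)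
                       , G-sym (o bd (b≢a ∘ proj₁) (b≢c ∘ proj₁))))
        where
        o : ∀ {x y} → G⁺ x y ≡ true → _ → _ → G x y ≡ true
        o = still-old pq
        b≢a = E⁺.G-irrefl ab ∘ sym
        a≢c = E⁺.G-irrefl ac
        b≢c = E⁺.G-irrefl bc
        ab′ = o ab (b≢c ∘ proj₂) (a≢c ∘ proj₁)

    completion : Completion u v
    completion with E⁺.diamond-exists one
    ... | _ , _ , _ , _ , D@(mkDiamond ab ac ad bc bd c≢d)
      with addEdge⁻ G ab | addEdge⁻ G ac | addEdge⁻ G ad | addEdge⁻ G bc | addEdge⁻ G bd
    -- Some edge of the diamond is new, since otherwise `G` would contain it. The symmetries of the
    -- diamond carry any new side to the position `a c`.
    ... | inj₂ pq | _ | _ | _ | _ = via-chord D pq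
    ... | _ | inj₂ pq | _ | _ | _ = via-side D pq
    ... | _ | _ | inj₂ pq | _ | _ = via-side (E⁺.swap-tips D) pq
    ... | _ | _ | _ | inj₂ pq | _ = via-side (E⁺.swap-chord D) pq
    ... | _ | _ | _ | _ | inj₂ pq = via-side (E⁺.swap-tips (E⁺.swap-chord D)) pq
    ... | inj₁ ab | inj₁ ac | inj₁ ad | inj₁ bc | inj₁ bd =
      ⊥-elim (diamond-free (proj₁ saturated) (mkDiamond ab ac ad bc bd c≢d))

    private
      chordD : ∀ {x y} → x ≢ y → Common u v x → Common u v y → Diamond G⁺ u v x y
      chordD x≢y (ux , xv) (uy , yv) = mkDiamond new (old ux) (old uy) (old (G-sym xv)) (old (G-sym yv)) x≢y

      leftD : ∀ {x} → Common u v x → (t : TriangleEdge u x) → Diamond G⁺ u x (proj₁ (proj₂ t)) v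
      leftD (ux , xv) (_ , s , us , sx) =
        mkDiamond (old ux) (old us) new (old (G-sym sx)) (old xv) λ {refl → not-¬ uv us}

      rightD : ∀ {x} → Common u v x → (t : TriangleEdge x v) → Diamond G⁺ v x (proj₁ (proj₂ t)) u
      rightD (ux , xv) (_ , s , xs , sv) =
        mkDiamond (old (G-sym xv)) (old (G-sym sv)) (E⁺.G-sym new) (old xs) (old (G-sym ux))
          λ {refl → not-¬ uv sv}

    -- This lemma and the next three each exhibit two different diamonds in `G⁺`. Here both have
    -- chord `u v` and a tip tells them apart; in the other three, the chords differ, being two of
    -- `u v`, `u x` and `v x`.
    chord⇒only : ∀ {x y z} → x ≢ y → Common u v x → Common u v y → Common u v z → z ≢ x → z ≢ y → ⊥
    chord⇒only x≢y cx cy cz z≢x z≢y =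
      E⁺.tip-unique one (chordD x≢y cx cy) (chordD z≢x cz cx) z≢x z≢y

    left⇒only : ∀ {x y} → Common u v x → TriangleEdge u x → Common u v y → y ≡ x
    left⇒only {x} {y} cx t cy with y ≟ x
    ... | yes y≡x = y≡x
    ... | no y≢x  = ⊥-elim (E⁺.chord-unique one (leftD cx t) (E⁺.swap-chord (chordD y≢x cy cx))
                      (u≢v ∘ sym) (G-irrefl (proj₂ cx) ∘ sym))

    right⇒only : ∀ {x y} → Common u v x → TriangleEdge x v → Common u v y → y ≡ x
    right⇒only {x} {y} cx t cy with y ≟ x
    ... | yes y≡x = y≡x
    ... | no y≢x  = ⊥-elim (E⁺.chord-unique one (rightD cx t) (chordD y≢x cy cx) u≢v (G-irrefl (proj₁ cx)))

    left⇒¬right : ∀ {x} → Common u v x → TriangleEdge u x → TriangleEdge x v → ⊥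
    left⇒¬right cx t t′ = E⁺.chord-unique one (leftD cx t) (rightD cx t′) (u≢v ∘ sym) (G-irrefl (proj₂ cx) ∘ sym)

-- Finite sums

∑-const : ∀ n c → ∑ {n} (const c) ≡ n Nat.* c
∑-const zero    c = refl
∑-const (suc n) c = cong (c +_) (∑-const n c)

∑-mono-≤ : ∀ {n} {f g : Fin n → ℕ} → (∀ i → f i ≤ g i) → ∑ f ≤ ∑ g
∑-mono-≤ {zero}  f≤g = z≤n
∑-mono-≤ {suc n} f≤g = +-mono-≤ (f≤g zero) (∑-mono-≤ (f≤g ∘ suc))

term≤∑ : ∀ {n} (f : Fin n → ℕ) i → f i ≤ ∑ f
term≤∑ f zero    = m≤m+n _ _
term≤∑ f (suc i) = ≤-trans (term≤∑ (f ∘ suc) i) (m≤n+m _ (f zero))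

-- Written additively to avoid subtraction. It serves the matrix identities below that hold at all
-- but one index and need a correction term there.
∑-agree-off : ∀ {n} {f g : Fin n → ℕ} j → (∀ i → i ≢ j → f i ≡ g i) → ∑ f + g j ≡ ∑ g + f j
∑-agree-off {suc n} {f} {g} j f≗g = begin
  ∑ f + g j                          ≡⟨ cong (_+ g j) (sum-remove f) ⟩
  f j + ∑ (f ∘ punchIn j) + g j      ≡⟨ cong (λ s → f j + s + g j) (sum-cong-≗ (λ i → f≗g _ (punchInᵢ≢i j i))) ⟩
  f j + ∑ (g ∘ punchIn j) + g j      ≡⟨ swap (f j) _ (g j) ⟩
  g j + ∑ (g ∘ punchIn j) + f j      ≡⟨ cong (_+ f j) (sum-remove g) ⟨
  ∑ g + f j                          ∎
  where
  open ≡-Reasoning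
  swap : ∀ x y z → x + y + z ≡ z + y + x
  swap = solve-∀

∑-zero : ∀ {n} (f : Fin n → ℕ) → (∀ i → f i ≡ 0) → ∑ f ≡ 0
∑-zero {n} f f≗0 = trans (sum-cong-≗ f≗0) (trans (∑-const n 0) (*-zeroʳ n))

∑-single : ∀ {n} {f : Fin n → ℕ} j → (∀ i → i ≢ j → f i ≡ 0) → ∑ f ≡ f j
∑-single {n} {f} j f≗0 = begin
  ∑ f                      ≡⟨ +-identityʳ _ ⟨
  ∑ f + 0                  ≡⟨ ∑-agree-off j f≗0 ⟩
  ∑ {n} (const 0) + f j    ≡⟨ cong (_+ f j) (∑-zero {n} (const 0) (λ _ → refl)) ⟩
  f j                      ∎
  where open ≡-Reasoning

∑-double : ∀ {n} {f : Fin n → ℕ} j k → j ≢ k → (∀ i → i ≢ j → i ≢ k → f i ≡ 0) → ∑ f ≡ f j + f k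
∑-double {n} {f} j k j≢k f≗0 = begin
  ∑ f          ≡⟨ +-identityʳ _ ⟨
  ∑ f + 0      ≡⟨ cong (∑ f +_) (updateAt-updates j f) ⟨
  ∑ f + g j    ≡⟨ ∑-agree-off j (λ i i≢j → sym (updateAt-minimal i j f i≢j)) ⟩
  ∑ g + f j    ≡⟨ cong (_+ f j) (∑-single k g≗0) ⟩
  g k + f j    ≡⟨ cong (_+ f j) (updateAt-minimal k j f (j≢k ∘ sym)) ⟩
  f k + f j    ≡⟨ +-comm (f k) (f j) ⟩
  f j + f k    ∎
  where
  open ≡-Reasoning
  -- Clearing the entry at `j` leaves at most the entry at `k`, so that `∑-single` applies.
  g = updateAt f j (const 0)
  g≗0 : ∀ i → i ≢ k → g i ≡ 0
  g≗0 i i≢k with i ≟ j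
  ... | yes refl = updateAt-updates j f
  ... | no i≢j   = trans (updateAt-minimal i j f i≢j) (f≗0 i i≢j i≢k)

ι : Bool → ℕ
ι true  = 1
ι false = 0

ι-∧ : ∀ a b → ι (a ∧ b) ≡ ι a Nat.* ι b
ι-∧ true  b = sym (+-identityʳ (ι b))
ι-∧ false b = refl

sum-allFin : ∀ {n} (f : Fin n → ℕ) → List.sum (map f (allFin n)) ≡ ∑ f
sum-allFin {n} f = trans (cong List.sum (map-tabulate (λ i → i) f)) (go f)
  where
  go : ∀ {n} (f : Fin n → ℕ) → List.sum (tabulate f) ≡ ∑ f
  go {zero}  f = refl
  go {suc n} f = cong (f zero +_) (go (f ∘ suc))

count≡sum : ∀ {A : Set} (p : A → Bool) xs → count p xs ≡ List.sum (map (ι ∘ p) xs)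
count≡sum p []       = refl
count≡sum p (x ∷ xs) with p x
... | true  = cong suc (count≡sum p xs)
... | false = count≡sum p xs

count-allFin : ∀ {n} (p : Fin n → Bool) → count p (allFin n) ≡ ∑ (ι ∘ p)
count-allFin p = trans (count≡sum p (allFin _)) (sum-allFin (ι ∘ p))

-- Adjacency

module Counting {n} (G : Adj n) (simple : SimpleGraph G) (saturated : UniquelyDiamondSaturated G) where

  open Nat using (_*_)
  open Embeddings G simple using (G-sym; G-irrefl)
  open Saturated G simple saturated

  -- Here `e` is the entrywise product of `a` and `c`; it takes only the values 0 and 1 because an
  -- edge lies in at most one triangle. The matrix product `s` of `a` and `e` counts walks of length
  -- 2 whose second edge lies in a triangle.
  a c e s : Fin n → Fin n → ℕ
  a x y = ι (G x y)
  c x y = ∑ λ z → a x z * a z y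
  e x y = a x y * c x y
  s x y = ∑ λ z → a x z * e z y

  deg τ : Fin n → ℕ
  deg x = ∑ (a x)
  τ x = ∑ (e x)

  G? : ∀ x y → Dec (G x y ≡ true)
  G? x y = G x y ≟ᵇ true

  a-yes : ∀ {x y} → G x y ≡ true → a x y ≡ 1
  a-yes = cong ι

  a-no : ∀ {x y} → G x y ≢ true → a x y ≡ 0
  a-no ¬xy = cong ι (¬-not ¬xy)

  a-sym : ∀ x y → a x y ≡ a y x
  a-sym x y = cong ι (proj₁ simple x y)

  a*≡0 : ∀ {x y t} → (G x y ≡ true → t ≡ 0) → a x y * t ≡ 0
  a*≡0 {x} {y} {t} t≡0 with G? x y
  ... | no ¬xy = cong (_* t) (a-no ¬xy)
  ... | yes xy = trans (cong (a x y *_) (t≡0 xy)) (*-zeroʳ (a x y))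

  c-term : ∀ {x y z} → Common x y z → a x z * a z y ≡ 1
  c-term (xz , zy) = cong₂ _*_ (a-yes xz) (a-yes zy)

  c-term0 : ∀ {x y z} → ¬ Common x y z → a x z * a z y ≡ 0
  c-term0 ¬c = a*≡0 λ xz → a-no λ zy → ¬c (xz , zy)

  c-sym : ∀ x y → c x y ≡ c y x
  c-sym x y = sum-cong-≗ λ z → trans (*-comm (a x z) _) (cong₂ _*_ (a-sym z y) (a-sym x z))

  c-diag : ∀ x → c x x ≡ deg x
  c-diag x = sum-cong-≗ λ z → trans (cong (a x z *_) (a-sym z x)) (idem (G x z))
    where
    idem : ∀ b → ι b * ι b ≡ ι b
    idem true  = refl
    idem false = refl

  c-none : ∀ {x y} → (∀ z → ¬ Common x y z) → c x y ≡ 0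
  c-none none = ∑-zero _ (λ z → c-term0 (none z))

  c-one : ∀ {x y z} → Common x y z → (∀ {w} → Common x y w → w ≡ z) → c x y ≡ 1
  c-one {z = z} com only = trans (∑-single z (λ w w≢z → c-term0 (w≢z ∘ only))) (c-term com)

  c-two : ∀ {x y z w} → z ≢ w → Common x y z → Common x y w →
    (∀ {v} → Common x y v → v ≢ z → v ≢ w → ⊥) → c x y ≡ 2
  c-two {z = z} {w} z≢w cz cw only = trans
    (∑-double z w z≢w (λ v v≢z v≢w → c-term0 (λ cv → only cv v≢z v≢w)))
    (cong₂ _+_ (c-term cz) (c-term cw))

  e-yes : ∀ {x y} → TriangleEdge x y → e x y ≡ 1
  e-yes (xy , z , com) = cong₂ _*_ (a-yes xy) (c-one com (λ com′ → common-unique xy com′ com))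

  e-no : ∀ {x y} → ¬ TriangleEdge x y → e x y ≡ 0
  e-no ¬t = a*≡0 λ xy → c-none λ z com → ¬t (xy , z , com)

  TriangleEdge? : ∀ x y → Dec (TriangleEdge x y)
  TriangleEdge? x y = G? x y ×-dec any? (λ z → G? x z ×-dec G? z y)

  e≤a : ∀ x y → e x y ≤ a x y
  e≤a x y with TriangleEdge? x y
  ... | yes t@(xy , _) = ≤-reflexive (trans (e-yes t) (sym (a-yes xy)))
  ... | no ¬t          = ≤-trans (≤-reflexive (e-no ¬t)) z≤n

  s-term0 : ∀ {x y z} → ¬ (G x z ≡ true × TriangleEdge z y) → a x z * e z y ≡ 0
  s-term0 ¬p = a*≡0 λ xz → e-no λ t → ¬p (xz , t)

  -- Vertices on triangles

  inA⁻ : ∀ {x} → inA G x ≡ true → ∃₂ λ y z → G x y ≡ true × G x z ≡ true × G y z ≡ true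
  inA⁻ x∈A with ∈-pairs⁻ {xs = allFin n} {ys = allFin n} (or⁻ x∈A)
  ... | y , z , eq = let xy , p = ∧⁻ (sym eq) ; xz , yz = ∧⁻ p in y , z , xy , xz , yz

  TriangleEdge⇒inA : ∀ {x y} → TriangleEdge x y → inA G x ≡ true
  TriangleEdge⇒inA {x} {y} (xy , z , xz , zy) =
    or⁺ (subst (_∈ triples) (∧⁺ xy (∧⁺ xz (G-sym zy))) (∈-pairs⁺ (∈-allFin y) (∈-allFin z)))
    where triples = concatMap (λ y → map (λ z → G x y ∧ G x z ∧ G y z) (allFin n)) (allFin n)

  ∉A⇒¬TriangleEdge : ∀ {x y} → inA G x ≡ false → ¬ TriangleEdge x y
  ∉A⇒¬TriangleEdge x∉A = not-¬ x∉A ∘ TriangleEdge⇒inA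

  α β : Fin n → ℕ
  α x = ι (inA G x)
  β x = ι (not (inA G x))

  -- Two triangles xyz and xwr meeting only at x would give y and w, non-adjacent, the common
  -- neighbour x with both xy and xw in a triangle.
  triangles-disjoint : ∀ {x y z w} → G x y ≡ true → G x z ≡ true → G y z ≡ true →
    TriangleEdge x w → w ≢ y → w ≢ z → ⊥
  triangles-disjoint {x} {y} {z} {w} xy xz yz t@(xw , _) w≢y w≢z with G? y w
  ... | yes yw = w≢z (common-unique xy (xw , G-sym yw) (xz , G-sym yz))
  ... | no ¬yw = NonEdge.left⇒¬right (w≢y ∘ sym) (¬-not ¬yw) (G-sym xy , xw)
                   (G-sym xy , z , yz , G-sym xz) t

  -- A vertex of `A` lies in exactly one triangle, which has two edges at it.
  τ≡2α : ∀ x → τ x ≡ 2 * α x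
  τ≡2α x with inA G x in x?A
  ... | false = ∑-zero (e x) (λ y → e-no (∉A⇒¬TriangleEdge x?A))
  ... | true  = let y , z , xy , xz , yz = inA⁻ x?A in trans
    (∑-double y z (G-irrefl yz) (λ w w≢y w≢z → e-no (λ t → triangles-disjoint xy xz yz t w≢y w≢z)))
    (cong₂ _+_ (e-yes (xy , z , xz , G-sym yz)) (e-yes (xz , y , xy , yz)))

  -- Degrees

  dA : Fin n → ℕ
  dA x = ∑ λ y → a x y * α y

  dB : Fin n → ℕ
  dB x = ∑ λ y → a x y * β y

  ∑aτ : ∀ x → ∑ (λ y → a x y * τ y) ≡ 2 * dA x
  ∑aτ x = begin
    ∑ (λ y → a x y * τ y)         ≡⟨ sum-cong-≗ (λ y → trans (cong (a x y *_) (τ≡2α y)) (lem (a x y) (α y))) ⟩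
    ∑ (λ y → 2 * (a x y * α y))   ≡⟨ *-distribˡ-sum 2 (λ y → a x y * α y) ⟨
    2 * dA x                      ∎
    where
    open ≡-Reasoning
    lem : ∀ p q → p * (2 * q) ≡ 2 * (p * q)
    lem = solve-∀

  -- Associativity of the product of a row vector, a matrix and a column vector.
  ∑-weighted : ∀ (p : Fin n → ℕ) (q : Fin n → Fin n → ℕ) (r : Fin n → ℕ) →
    ∑ (λ y → ∑ (λ x → p x * q x y) * r y) ≡ ∑ (λ x → p x * ∑ (λ y → q x y * r y))
  ∑-weighted p q r = begin
    ∑ (λ y → ∑ (λ x → p x * q x y) * r y)       ≡⟨ sum-cong-≗ (λ y → *-distribʳ-sum (r y) (λ x → p x * q x y)) ⟩
    ∑ (λ y → ∑ (λ x → p x * q x y * r y))       ≡⟨ ∑-comm (λ y x → p x * q x y * r y) ⟩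
    ∑ (λ x → ∑ (λ y → p x * q x y * r y))       ≡⟨ sum-cong-≗ (λ x → sum-cong-≗ (λ y → *-assoc (p x) (q x y) (r y))) ⟩
    ∑ (λ x → ∑ (λ y → p x * (q x y * r y)))     ≡⟨ sum-cong-≗ (λ x → *-distribˡ-sum (p x) (λ y → q x y * r y)) ⟨
    ∑ (λ x → p x * ∑ (λ y → q x y * r y))       ∎
    where open ≡-Reasoning

  ∑-rows : ∀ (p : Fin n → ℕ) (q : Fin n → Fin n → ℕ) →
    ∑ (λ y → ∑ (λ x → p x * q x y)) ≡ ∑ (λ x → p x * ∑ (q x))
  ∑-rows p q = trans (∑-comm (λ y x → p x * q x y)) (sum-cong-≗ (λ x → sym (*-distribˡ-sum (p x) (q x))))

  -- The cube of a symmetric matrix is symmetric: reversing a walk of length 3 exchanges its ends.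
  walks-sym : ∀ u v → ∑ (λ x → a u x * c x v) ≡ ∑ (λ x → a v x * c x u)
  walks-sym u v = begin
    ∑ (λ x → a u x * c x v)     ≡⟨ ∑-weighted (a u) a (λ y → a y v) ⟨
    ∑ (λ y → c u y * a y v)     ≡⟨ sum-cong-≗ (λ y → trans (*-comm (c u y) _) (cong₂ _*_ (a-sym y v) (c-sym u y))) ⟩
    ∑ (λ y → a v y * c y u)     ∎
    where open ≡-Reasoning

  module Outside {u} (u∉A : inA G u ≡ false) where

    private
      no-left : ∀ {x} → ¬ TriangleEdge u x
      no-left = ∉A⇒¬TriangleEdge u∉A

      no-right : ∀ {x} → ¬ TriangleEdge x u
      no-right = no-left ∘ TriangleEdge-sym

    -- Saturation as one linear identity on row `u`. An edge `u z` contributes 0 + 2 + 0, since a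
    -- common neighbour would put `u` in a triangle. For a non-edge `left` is impossible; `chord`
    -- contributes 2 + 0 + 0 and `right` contributes 1 + 0 + 1.
    common-count : ∀ {z} → z ≢ u → c u z + 2 * a u z + s u z ≡ 2
    common-count {z} z≢u with G? u z
    ... | yes uz = cong₂ _+_
      (cong₂ _+_ (c-none (λ x com → no-left (uz , x , com))) (cong (2 *_) (a-yes uz)))
      (∑-zero (λ x → a u x * e x z) (λ x → s-term0 λ { (ux , xz , _) → no-left (uz , x , ux , xz) }))
    ... | no ¬uz = trans (cong (λ p → c u z + 2 * p + s u z) (a-no ¬uz)) (by completion)
      where
      open NonEdge {u} {z} (z≢u ∘ sym) (¬-not ¬uz)
      by : Completion u z → c u z + 0 + s u z ≡ 2
      by (left _ t) = ⊥-elim (no-left t)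
      by (chord x≢y cx cy) = cong₂ _+_ (cong (_+ 0) (c-two x≢y cx cy (chord⇒only x≢y cx cy)))
        (∑-zero (λ w → a u w * e w z) (λ w → s-term0 λ { (uw , t@(wz , _)) →
          x≢y (trans (right⇒only (uw , wz) t cx) (sym (right⇒only (uw , wz) t cy))) }))
      by (right {x} cx t) = cong₂ _+_ (cong (_+ 0) (c-one cx (right⇒only cx t)))
        (trans (∑-single x (λ w w≢x → s-term0 λ { (uw , t′@(wz , _)) → w≢x (right⇒only cx t (uw , wz)) }))
               (cong₂ _*_ (a-yes (proj₁ cx)) (e-yes t)))

    s-diag : s u u ≡ 0
    s-diag = ∑-zero (λ x → a u x * e x u) (λ x → s-term0 (no-right ∘ proj₂))

    -- `common-count` summed over all `z`. At `z = u` the summand is `deg u` instead of 2, whence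
    -- the corrections on both sides.
    ∑c : ∑ (c u) + 2 * deg u + 2 * dA u + 2 ≡ n * 2 + deg u
    ∑c = begin
      ∑ (c u) + 2 * deg u + 2 * dA u + 2         ≡⟨ cong (_+ 2) split ⟨
      ∑ (λ z → c u z + 2 * a u z + s u z) + 2    ≡⟨ ∑-agree-off u (λ z → common-count) ⟩
      ∑ {n} (const 2) + (c u u + 2 * a u u + s u u)  ≡⟨ cong₂ _+_ (∑-const n 2) diag ⟩
      n * 2 + deg u                              ∎
      where
      open ≡-Reasoning
      split : ∑ (λ z → c u z + 2 * a u z + s u z) ≡ ∑ (c u) + 2 * deg u + 2 * dA u
      split = begin
        ∑ (λ z → c u z + 2 * a u z + s u z)            ≡⟨ ∑-distrib-+ _ (s u) ⟩
        ∑ (λ z → c u z + 2 * a u z) + ∑ (s u)          ≡⟨ cong (_+ ∑ (s u)) (∑-distrib-+ (c u) _) ⟩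
        ∑ (c u) + ∑ (λ z → 2 * a u z) + ∑ (s u)        ≡⟨ cong₂ (λ p q → ∑ (c u) + p + q) (sym (*-distribˡ-sum 2 (a u)))
                                                            (trans (∑-rows (a u) e) (∑aτ u)) ⟩
        ∑ (c u) + 2 * deg u + 2 * dA u                 ∎
      diag : c u u + 2 * a u u + s u u ≡ deg u
      diag = begin
        c u u + 2 * a u u + s u u   ≡⟨ cong₂ (λ p q → c u u + 2 * p + q) (cong ι (proj₂ simple u)) s-diag ⟩
        c u u + 0 + 0               ≡⟨ trans (+-identityʳ _) (+-identityʳ _) ⟩
        c u u                       ≡⟨ c-diag u ⟩
        deg u                       ∎

    module _ {v} (uv : G u v ≡ true) where

      -- Since `u` is a common neighbour of `x` and `v`, a completion of type `left` or `right`
      -- would have `u` as its middle vertex and put `u` in a triangle. Only `chord` remains.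
      c-across-u : ∀ {x} → G u x ≡ true → x ≢ v → c x v ≡ 2
      c-across-u {x} ux x≢v = by completion
        where
        open NonEdge {x} {v} x≢v (¬-not (λ xv → no-left (ux , v , uv , G-sym xv)))
        by : Completion x v → c x v ≡ 2
        by (chord y≢z cy cz) = c-two y≢z cy cz (chord⇒only y≢z cy cz)
        by (left cy t) with refl ← left⇒only cy t (G-sym ux , uv) = ⊥-elim (no-right t)
        by (right cy t) with refl ← right⇒only cy t (G-sym ux , uv) = ⊥-elim (no-left t)

      -- Now `v` is a common neighbour of `u` and `x`. Either there are two common neighbours and
      -- `v x` lies in no triangle, or `v` is the only one and `v x` lies in a triangle; the term
      -- `e v x` evens out the two cases.
      c-across-v : ∀ {x} → G v x ≡ true → x ≢ u → c x u + e v x ≡ 2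
      c-across-v {x} vx x≢u = trans (cong (_+ e v x) (c-sym x u)) (by completion)
        where
        open NonEdge {u} {x} (x≢u ∘ sym) (¬-not (λ ux → no-left (uv , x , ux , G-sym vx)))
        by : Completion u x → c u x + e v x ≡ 2
        by (left _ t) = ⊥-elim (no-left t)
        by (chord y≢z cy cz) = cong₂ _+_ (c-two y≢z cy cz (chord⇒only y≢z cy cz))
          (e-no λ t → y≢z (trans (right⇒only (uv , vx) t cy) (sym (right⇒only (uv , vx) t cz))))
        by (right cy t) with refl ← right⇒only cy t (uv , vx) =
          cong₂ _+_ (c-one cy (right⇒only cy t)) (e-yes t)

      deg-neighbour : deg v ≡ deg u + τ v
      deg-neighbour = cancel (deg u) (deg v) (τ v) _ from-u from-v
        where
        open ≡-Reasoning
        -- The number of walks of length 3 from `u` to `v`.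
        W = ∑ (λ x → a u x * c x v)

        -- Each neighbour `x` of `u` contributes 2, except that `x = v` contributes `c v v = deg v`.
        from-u : W + 2 ≡ 2 * deg u + deg v
        from-u = begin
          W + 2                                   ≡⟨ cong (λ p → W + 2 * p) (a-yes uv) ⟨
          W + 2 * a u v                           ≡⟨ ∑-agree-off v pointwise ⟩
          ∑ (λ x → 2 * a u x) + a u v * c v v     ≡⟨ cong₂ _+_ (sym (*-distribˡ-sum 2 (a u)))
                                                       (trans (cong₂ _*_ (a-yes uv) (c-diag v)) (*-identityˡ (deg v))) ⟩
          2 * deg u + deg v                       ∎
          where
          pointwise : ∀ x → x ≢ v → a u x * c x v ≡ 2 * a u x
          pointwise x x≢v with G? u x
          ... | no ¬ux rewrite a-no ¬ux = refl
          ... | yes ux rewrite a-yes ux = trans (*-identityˡ (c x v)) (c-across-u ux x≢v)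

        -- Read from `v`, each neighbour contributes 2 once `e v x` is added, and these additions
        -- total `τ v`. The exception `x = u` contributes `deg u`.
        from-v : W + τ v + 2 ≡ 2 * deg v + deg u
        from-v = begin
          W + τ v + 2                                          ≡⟨ cong (λ p → p + τ v + 2) (walks-sym u v) ⟩
          ∑ (λ x → a v x * c x u) + τ v + 2                    ≡⟨ cong (_+ 2) (∑-distrib-+ (λ x → a v x * c x u) (e v)) ⟨
          ∑ (λ x → a v x * c x u + e v x) + 2                  ≡⟨ cong (λ p → ∑ (λ x → a v x * c x u + e v x) + 2 * p) (a-yes (G-sym uv)) ⟨
          ∑ (λ x → a v x * c x u + e v x) + 2 * a v u          ≡⟨ ∑-agree-off u pointwise ⟩
          ∑ (λ x → 2 * a v x) + (a v u * c u u + e v u)        ≡⟨ cong₂ _+_ (sym (*-distribˡ-sum 2 (a v)))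
                                                                    (cong₂ _+_ (cong₂ _*_ (a-yes (G-sym uv)) (c-diag u)) (e-no no-right)) ⟩
          2 * deg v + (1 * deg u + 0)                          ≡⟨ cong (2 * deg v +_) (trans (+-identityʳ _) (*-identityˡ (deg u))) ⟩
          2 * deg v + deg u                                    ∎
          where
          pointwise : ∀ x → x ≢ u → a v x * c x u + e v x ≡ 2 * a v x
          pointwise x x≢u with G? v x
          ... | no ¬vx rewrite a-no ¬vx = refl
          ... | yes vx = trans (cong (λ p → p * c x u + e v x) (a-yes vx))
            (trans (cong (_+ e v x) (*-identityˡ (c x u))) (trans (c-across-v vx x≢u) (sym (cong (2 *_) (a-yes vx)))))

        cancel : ∀ p q r w → w + 2 ≡ 2 * p + q → w + r + 2 ≡ 2 * q + p → q ≡ p + r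
        cancel p q r w eq₁ eq₂ = +-cancelʳ-≡ (p + q) q (p + r) (begin
          q + (p + q)       ≡⟨ l₁ p q ⟩
          2 * q + p         ≡⟨ eq₂ ⟨
          w + r + 2         ≡⟨ l₂ w r ⟩
          w + 2 + r         ≡⟨ cong (_+ r) eq₁ ⟩
          2 * p + q + r     ≡⟨ l₃ p q r ⟩
          p + r + (p + q)   ∎)
          where
          l₁ : ∀ p q → q + (p + q) ≡ 2 * q + p
          l₁ = solve-∀
          l₂ : ∀ w r → w + r + 2 ≡ w + 2 + r
          l₂ = solve-∀
          l₃ : ∀ p q r → 2 * p + q + r ≡ p + r + (p + q)
          l₃ = solve-∀

    -- The walks of length 2 from `u` are counted in two ways: by their last vertex in `∑c`, and by
    -- their middle vertex `x`, whose degree is `deg u + τ x`.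
    order : n * 2 ≡ deg u * deg u + deg u + 4 * dA u + 2
    order = +-cancelʳ-≡ (deg u) _ _ (begin
      n * 2 + deg u                                              ≡⟨ ∑c ⟨
      ∑ (c u) + 2 * deg u + 2 * dA u + 2                         ≡⟨ cong (λ p → p + 2 * deg u + 2 * dA u + 2) walks ⟩
      (deg u * deg u + 2 * dA u) + 2 * deg u + 2 * dA u + 2      ≡⟨ lem (deg u) (dA u) ⟩
      deg u * deg u + deg u + 4 * dA u + 2 + deg u               ∎)
      where
      open ≡-Reasoning
      lem : ∀ m d → (m * m + 2 * d) + 2 * m + 2 * d + 2 ≡ m * m + m + 4 * d + 2 + m
      lem = solve-∀
      pointwise : ∀ x → a u x * deg x ≡ deg u * a u x + a u x * τ x
      pointwise x with G? u x
      ... | no ¬ux rewrite a-no ¬ux = sym (trans (+-identityʳ _) (*-zeroʳ (deg u)))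
      ... | yes ux rewrite a-yes ux | deg-neighbour ux = lem′ (deg u) (τ x)
        where
        lem′ : ∀ m t → 1 * (m + t) ≡ m * 1 + 1 * t
        lem′ = solve-∀
      walks : ∑ (c u) ≡ deg u * deg u + 2 * dA u
      walks = begin
        ∑ (c u)                                              ≡⟨ ∑-rows (a u) a ⟩
        ∑ (λ x → a u x * deg x)                              ≡⟨ sum-cong-≗ pointwise ⟩
        ∑ (λ x → deg u * a u x + a u x * τ x)                ≡⟨ ∑-distrib-+ (λ x → deg u * a u x) _ ⟩
        ∑ (λ x → deg u * a u x) + ∑ (λ x → a u x * τ x)      ≡⟨ cong₂ _+_ (sym (*-distribˡ-sum (deg u) (a u))) (∑aτ u) ⟩
        deg u * deg u + 2 * dA u                             ∎

  -- Outside `A` adjacent vertices have equal degrees, as `τ v` vanishes; comparing `order` at both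
  -- then leaves only the terms `4 * dA`.
  dA-neighbour : ∀ {u v} → inA G u ≡ false → inA G v ≡ false → G u v ≡ true → dA u ≡ dA v
  dA-neighbour {u} {v} u∉A v∉A uv = *-cancelˡ-≡ (dA u) (dA v) 4
    (+-cancelˡ-≡ (deg u * deg u + deg u) (4 * dA u) (4 * dA v) (+-cancelʳ-≡ 2 _ _ (begin
      deg u * deg u + deg u + 4 * dA u + 2   ≡⟨ Outside.order u∉A ⟨
      n * 2                                  ≡⟨ Outside.order v∉A ⟩
      deg v * deg v + deg v + 4 * dA v + 2   ≡⟨ cong (λ m → m * m + m + 4 * dA v + 2) deg-eq ⟩
      deg u * deg u + deg u + 4 * dA v + 2   ∎)))
    where
    open ≡-Reasoning
    deg-eq : deg v ≡ deg u
    deg-eq = trans (Outside.deg-neighbour u∉A uv)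
      (trans (cong (deg u +_) (trans (τ≡2α v) (cong (λ b → 2 * ι b) v∉A))) (+-identityʳ (deg u)))

  -- The bound on the degree

  common-outside : Fin n → Fin n → ℕ
  common-outside u x = ∑ λ w → a u w * (β w * a w x)

  -- The two terms count disjoint sets of common neighbours: no edge at a vertex outside `A` lies in
  -- a triangle.
  common-outside+s≤c : ∀ u x → common-outside u x + s u x ≤ c u x
  common-outside+s≤c u x = begin
    common-outside u x + s u x                            ≡⟨ ∑-distrib-+ (λ w → a u w * (β w * a w x)) _ ⟨
    ∑ (λ w → a u w * (β w * a w x) + a u w * e w x)       ≤⟨ ∑-mono-≤ pointwise ⟩
    c u x                                                 ∎
    where
    open ≤-Reasoning
    on-edge : ∀ w → β w * a w x + e w x ≤ a w x
    on-edge w with inA G w in w?A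
    ... | true  = e≤a w x
    ... | false = ≤-reflexive (trans (cong₂ _+_ (*-identityˡ (a w x)) (e-no (∉A⇒¬TriangleEdge w?A))) (+-identityʳ (a w x)))
    pointwise : ∀ w → a u w * (β w * a w x) + a u w * e w x ≤ a u w * a w x
    pointwise w = begin
      a u w * (β w * a w x) + a u w * e w x   ≡⟨ *-distribˡ-+ (a u w) (β w * a w x) (e w x) ⟨
      a u w * (β w * a w x + e w x)           ≤⟨ *-monoʳ-≤ (a u w) (on-edge w) ⟩
      a u w * a w x                           ∎

  module _ {u} (u∉A : inA G u ≡ false) where

    open Outside u∉A using (common-count)

    -- Each vertex of `A` has an allowance of 2. A triangle met by `u` exhausts it at all three of
    -- its vertices: through `2 * a` at the neighbour of `u`, and through `2 * s` at the other two.
    -- So neighbours of `u` outside `A` reach only the remaining triangles.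
    reached : ∀ x → common-outside u x * α x + 2 * (a u x * α x) + 2 * s u x ≤ 2 * α x
    reached x with inA G x in x?A
    ... | false = ≤-reflexive (begin
      common-outside u x * 0 + 2 * (a u x * 0) + 2 * s u x   ≡⟨ lem (common-outside u x) (a u x) (s u x) ⟩
      2 * s u x                                              ≡⟨ cong (2 *_) s≡0 ⟩
      0                                                      ∎)
      where
      open ≡-Reasoning
      lem : ∀ p q r → p * 0 + 2 * (q * 0) + 2 * r ≡ 2 * r
      lem = solve-∀
      s≡0 : s u x ≡ 0
      s≡0 = ∑-zero (λ w → a u w * e w x) (λ w → s-term0 (∉A⇒¬TriangleEdge x?A ∘ TriangleEdge-sym ∘ proj₂))
    ... | true = begin
      common-outside u x * 1 + 2 * (a u x * 1) + 2 * s u x   ≡⟨ lem (common-outside u x) (a u x) (s u x) ⟩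
      (common-outside u x + s u x) + 2 * a u x + s u x       ≤⟨ +-monoˡ-≤ (s u x) (+-monoˡ-≤ (2 * a u x) (common-outside+s≤c u x)) ⟩
      c u x + 2 * a u x + s u x                              ≡⟨ common-count (λ { refl → not-¬ u∉A x?A }) ⟩
      2                                                      ∎
      where
      open ≤-Reasoning
      lem : ∀ p q r → p * 1 + 2 * (q * 1) + 2 * r ≡ (p + r) + 2 * q + r
      lem = solve-∀

    -- The row `s u` sums to `2 * dA u`, so the terms in `a` and `s` give 2 + 4 = 6 times `dA u`.
    -- The first sum counts the walks from `u` through a vertex outside `A` into `A`.
    ∑-reached : ∑ (λ w → a u w * β w * dA w) + 6 * dA u ≤ 2 * ∑ α
    ∑-reached = begin
      ∑ (λ w → a u w * β w * dA w) + 6 * dA u                     ≡⟨ split ⟨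
      ∑ (λ x → common-outside u x * α x + 2 * (a u x * α x) + 2 * s u x)   ≤⟨ ∑-mono-≤ reached ⟩
      ∑ (λ x → 2 * α x)                                           ≡⟨ *-distribˡ-sum 2 α ⟨
      2 * ∑ α                                                     ∎
      where
      lem : ∀ p d → p + 2 * d + 2 * (2 * d) ≡ p + 6 * d
      lem = solve-∀
      split : ∑ (λ x → common-outside u x * α x + 2 * (a u x * α x) + 2 * s u x)
              ≡ ∑ (λ w → a u w * β w * dA w) + 6 * dA u
      split = begin
        ∑ (λ x → common-outside u x * α x + 2 * (a u x * α x) + 2 * s u x)
          ≡⟨ ∑-distrib-+ (λ x → common-outside u x * α x + 2 * (a u x * α x)) _ ⟩
        ∑ (λ x → common-outside u x * α x + 2 * (a u x * α x)) + ∑ (λ x → 2 * s u x)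
          ≡⟨ cong₂ _+_ (∑-distrib-+ (λ x → common-outside u x * α x) _) (sym (*-distribˡ-sum 2 (s u))) ⟩
        ∑ (λ x → common-outside u x * α x) + ∑ (λ x → 2 * (a u x * α x)) + 2 * ∑ (s u)
          ≡⟨ cong₂ _+_ (cong₂ _+_ outside (sym (*-distribˡ-sum 2 (λ x → a u x * α x))))
                       (cong (2 *_) (trans (∑-rows (a u) e) (∑aτ u))) ⟩
        ∑ (λ w → a u w * β w * dA w) + 2 * dA u + 2 * (2 * dA u)
          ≡⟨ lem (∑ (λ w → a u w * β w * dA w)) (dA u) ⟩
        ∑ (λ w → a u w * β w * dA w) + 6 * dA u
          ∎
        where
        open ≡-Reasoning
        outside : ∑ (λ x → common-outside u x * α x) ≡ ∑ (λ w → a u w * β w * dA w)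
        outside = trans
          (sum-cong-≗ (λ x → cong (_* α x) (sum-cong-≗ (λ w → sym (*-assoc (a u w) (β w) (a w x))))))
          (∑-weighted (λ w → a u w * β w) a α)
      open ≤-Reasoning

    -- By `dA-neighbour` every neighbour `w` of `u` outside `A` has `dA w = dA u`, which is at least
    -- 1, so each is counted at least once in `∑-reached`.
    dB-bound : 1 ≤ dA u → dB u + 6 * dA u ≤ 2 * ∑ α
    dB-bound 1≤dA = ≤-trans (+-monoˡ-≤ (6 * dA u) (∑-mono-≤ pointwise)) ∑-reached
      where
      pointwise : ∀ w → a u w * β w ≤ a u w * β w * dA w
      pointwise w with G u w in uw | inA G w in w?A
      ... | false | _     = z≤n
      ... | true  | true  = z≤n
      ... | true  | false = ≤-trans 1≤dA (≤-reflexive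
                              (trans (dA-neighbour u∉A w?A uw) (sym (*-identityˡ (dA w)))))

  deg≡dA+dB : ∀ u → deg u ≡ dA u + dB u
  deg≡dA+dB u = trans (sum-cong-≗ (λ w → pointwise (a u w) (inA G w))) (∑-distrib-+ (λ w → a u w * α w) _)
    where
    pointwise : ∀ p b → p ≡ p * ι b + p * ι (not b)
    pointwise p true  = sym (trans (cong₂ _+_ (*-identityʳ p) (*-zeroʳ p)) (+-identityʳ p))
    pointwise p false = sym (cong₂ _+_ (*-zeroʳ p) (*-identityʳ p))

  degA≡dA : ∀ u → degA G u ≡ dA u
  degA≡dA u = trans (count-allFin (λ v → G u v ∧ inA G v)) (sum-cong-≗ (λ v → ι-∧ (G u v) (inA G v)))

  inNA⁻ : ∀ {u} → inNA G u ≡ true → inA G u ≡ false × 1 ≤ dA u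
  inNA⁻ {u} u∈NA with inA G u | ∧⁻ {not (inA G u)} u∈NA
  ... | false | _ , some with ∈-map⁻ (λ v → G u v ∧ inA G v) {xs = allFin n} (or⁻ some)
  ... | v , _ , eq = let uv , v∈A = ∧⁻ (sym eq) in refl ,
    ≤-trans (≤-reflexive (sym (cong₂ _*_ (a-yes uv) (cong ι v∈A)))) (term≤∑ (λ v → a u v * α v) v)

  -- Counting triangles

  isTriangle : Fin n → Fin n → Fin n → Bool
  isTriangle x y z = (x <F y) ∧ (y <F z) ∧ G x y ∧ G x z ∧ G y z

  T : Fin n → Fin n → Fin n → ℕ
  T x y z = ι (isTriangle x y z)

  triangles≡∑ : triangles G ≡ ∑ λ x → ∑ λ y → ∑ λ z → T x y z
  triangles≡∑ = trans (sum-allFin (λ x → List.sum (map (row x) (allFin n)))) (sum-cong-≗ λ x →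
    trans (sum-allFin (row x)) (sum-cong-≗ λ y → count-allFin (isTriangle x y)))
    where
    row : Fin n → Fin n → ℕ
    row x y = count (isTriangle x y) (allFin n)

  <⇒<F : ∀ {x y : Fin n} → x <ᶠ y → (x <F y) ≡ true
  <⇒<F x<y = Equivalence.to T-≡ (<⇒<ᵇ x<y)

  T-yes : ∀ {x y z} → x <ᶠ y → y <ᶠ z → G x y ≡ true → G x z ≡ true → G y z ≡ true → T x y z ≡ 1
  T-yes x<y y<z xy xz yz = cong ι (∧⁺ (<⇒<F x<y) (∧⁺ (<⇒<F y<z) (∧⁺ xy (∧⁺ xz yz))))

  -- The three possible places of `v` in an increasing triple whose other entries are `y` and `z`,
  -- in this order.
  at : Fin n → Fin n → Fin n → ℕ
  at v y z = T v y z + T y v z + T y z v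

  α≤at : ∀ v → α v ≤ ∑ λ y → ∑ λ z → at v y z
  α≤at v with inA G v in v?A
  ... | false = z≤n
  ... | true  = let y , z , vy , vz , yz = inA⁻ v?A in some vy vz yz
    where
    found : ∀ y z → 1 ≤ at v y z → 1 ≤ ∑ λ y → ∑ λ z → at v y z
    found y z 1≤ = ≤-trans 1≤ (≤-trans (term≤∑ (at v y) z) (term≤∑ (λ y → ∑ (at v y)) y))
    ordered : ∀ {y z} → y <ᶠ z → G v y ≡ true → G v z ≡ true → G y z ≡ true → 1 ≤ at v y z
    ordered {y} {z} y<z vy vz yz with <ᶠ-cmp v y | <ᶠ-cmp v z
    ... | tri< v<y _ _ | _ = ≤-trans (≤-reflexive (sym (T-yes v<y y<z vy vz yz))) (≤-trans (m≤m+n _ (T y v z)) (m≤m+n _ _))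
    ... | tri≈ _ v≡y _ | _ = contradiction v≡y (G-irrefl vy)
    ... | tri> _ _ y<v | tri< v<z _ _ = ≤-trans (≤-reflexive (sym (T-yes y<v v<z (G-sym vy) yz vz))) (≤-trans (m≤n+m _ (T v y z)) (m≤m+n _ _))
    ... | tri> _ _ y<v | tri≈ _ v≡z _ = contradiction v≡z (G-irrefl vz)
    ... | tri> _ _ y<v | tri> _ _ z<v = ≤-trans (≤-reflexive (sym (T-yes y<z z<v yz (G-sym vy) (G-sym vz)))) (m≤n+m _ _)
    some : ∀ {y z} → G v y ≡ true → G v z ≡ true → G y z ≡ true → 1 ≤ ∑ λ y → ∑ λ z → at v y z
    some {y} {z} vy vz yz with <ᶠ-cmp y z
    ... | tri< y<z _ _ = found y z (ordered y<z vy vz yz)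
    ... | tri≈ _ y≡z _ = contradiction y≡z (G-irrefl yz)
    ... | tri> _ _ z<y = found z y (ordered z<y vz vy (G-sym yz))

  -- Each of the three places in `at` sums to the number of triangles once the order of summation is
  -- changed.
  ∑α≤3*triangles : ∑ α ≤ 3 * triangles G
  ∑α≤3*triangles = begin
    ∑ α                                         ≤⟨ ∑-mono-≤ α≤at ⟩
    ∑³ at                                       ≡⟨ ∑³-+ (λ x y z → T x y z + T y x z) (λ x y z → T y z x) ⟩
    ∑³ (λ x y z → T x y z + T y x z) + ∑³ (λ x y z → T y z x)
                                                ≡⟨ cong₂ _+_ (∑³-+ T (λ x y z → T y x z)) last ⟩
    ∑³ T + ∑³ (λ x y z → T y x z) + ∑³ T        ≡⟨ cong (λ p → ∑³ T + p + ∑³ T) (∑-comm (λ x y → ∑ λ z → T y x z)) ⟩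
    ∑³ T + ∑³ T + ∑³ T                          ≡⟨ lem (∑³ T) ⟩
    3 * ∑³ T                                    ≡⟨ cong (3 *_) triangles≡∑ ⟨
    3 * triangles G                             ∎
    where
    open ≤-Reasoning
    ∑³ : (Fin n → Fin n → Fin n → ℕ) → ℕ
    ∑³ f = ∑ λ x → ∑ λ y → ∑ λ z → f x y z
    ∑³-+ : ∀ f g → ∑³ (λ x y z → f x y z + g x y z) ≡ ∑³ f + ∑³ g
    ∑³-+ f g = trans
      (sum-cong-≗ λ x → trans (sum-cong-≗ λ y → ∑-distrib-+ (f x y) (g x y)) (∑-distrib-+ (λ y → ∑ (f x y)) _))
      (∑-distrib-+ (λ x → ∑ λ y → ∑ (f x y)) _)
    last : ∑³ (λ x y z → T y z x) ≡ ∑³ T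
    last = trans (∑-comm (λ x y → ∑ λ z → T y z x)) (sum-cong-≗ λ y → ∑-comm (λ x z → T y z x))
    lem : ∀ p → p + p + p ≡ 3 * p
    lem = solve-∀

  -- Holds at every vertex of `N(A)`, with its own `t`. Writing `k` as `d + t` and doubling avoids
  -- both subtraction and fractions.
  bound : ∀ {u} → inNA G u ≡ true → let d = degA G u in ∃ λ t → triangles G ≡ d + t ×
    2 * n ≤ (d + t) * (d + t) + (10 * t + 5) * (d + t) + (25 * t * t + 7 * t) + 2
  bound {u} u∈NA rewrite degA≡dA u = t , sym (m+[n∸m]≡n d≤k) , (begin
    2 * n
      ≡⟨ *-comm 2 n ⟩
    n * 2
      ≡⟨ Outside.order u∉A ⟩
    deg u * deg u + deg u + 4 * d + 2
      ≤⟨ +-monoˡ-≤ 2 (+-monoˡ-≤ (4 * d) (+-mono-≤ (*-mono-≤ deg≤ deg≤) deg≤)) ⟩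
    (d + 6 * t) * (d + 6 * t) + (d + 6 * t) + 4 * d + 2
      -- The claimed bound exceeds what the degree estimate gives by exactly `6 * t`.
      ≤⟨ m≤m+n _ (6 * t) ⟩
    (d + 6 * t) * (d + 6 * t) + (d + 6 * t) + 4 * d + 2 + 6 * t
      ≡⟨ expand d t ⟩
    (d + t) * (d + t) + (10 * t + 5) * (d + t) + (25 * t * t + 7 * t) + 2
      ∎)
    where
    open ≤-Reasoning
    k = triangles G
    d = dA u
    t = k ∸ d
    u∉A = proj₁ (inNA⁻ u∈NA)
    expand : ∀ d t → (d + 6 * t) * (d + 6 * t) + (d + 6 * t) + 4 * d + 2 + 6 * t
             ≡ (d + t) * (d + t) + (10 * t + 5) * (d + t) + (25 * t * t + 7 * t) + 2
    expand = solve-∀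
    total : dB u + 6 * dA u ≤ 6 * k
    total = begin
      dB u + 6 * dA u    ≤⟨ dB-bound u∉A (proj₂ (inNA⁻ u∈NA)) ⟩
      2 * ∑ α            ≤⟨ *-monoʳ-≤ 2 ∑α≤3*triangles ⟩
      2 * (3 * k)        ≡⟨ *-assoc 2 3 k ⟨
      6 * k              ∎
    -- This makes the truncated subtraction in `t` exact.
    d≤k : dA u ≤ k
    d≤k = *-cancelˡ-≤ 6 (≤-trans (m≤n+m (6 * dA u) (dB u)) total)
    deg≤ : deg u ≤ dA u + 6 * t
    deg≤ = begin
      deg u              ≡⟨ deg≡dA+dB u ⟩
      dA u + dB u        ≤⟨ +-monoʳ-≤ (dA u) (m+n≤o⇒m≤o∸n (dB u) total) ⟩
      dA u + (6 * k ∸ 6 * dA u)   ≡⟨ cong (dA u +_) (*-distribˡ-∸ 6 k (dA u)) ⟨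
      dA u + 6 * t       ∎

-- Imported only here: the constructor +_ makes the sections of _+_ above unparsable.
open import Data.Integer using (ℤ; +_; _-_; _*_) renaming (_+_ to _+ℤ_; _≤_ to _≤ℤ_)
import Data.Integer as Int using (+≤+)
import Data.Integer.Properties as Int using (m-n≡m⊖n; ⊖-≥; pos-*)

-- Passage to the integers.

[d+t]-d≡t : ∀ d t → + (d + t) - + d ≡ + t
[d+t]-d≡t d t = trans (Int.m-n≡m⊖n (d + t) d)
  (trans (Int.⊖-≥ (m≤m+n d t)) (cong +_ (m+n∸m≡n d t)))

-- Sums of nonnegative integers compute to the image of the sum, so only the products need
-- rewriting.
pos-bound : ∀ k t →
  + (k Nat.* k + (10 Nat.* t + 5) Nat.* k + (25 Nat.* t Nat.* t + 7 Nat.* t) + 2)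
  ≡ + k * + k +ℤ (+ 10 * + t +ℤ + 5) * + k +ℤ (+ 25 * + t * + t +ℤ + 7 * + t) +ℤ + 2
pos-bound k t
  rewrite sym (Int.pos-* k k) | sym (Int.pos-* 10 t) | sym (Int.pos-* (10 Nat.* t + 5) k)
        | sym (Int.pos-* 25 t) | sym (Int.pos-* (25 Nat.* t) t) | sym (Int.pos-* 7 t) = refl

theorem3p4 : (n : ℕ) (G : Adj n) → SimpleGraph G → UniquelyDiamondSaturated G →
    (k : ℕ) → triangles G ≡ k → 2 ≤ k →
    (t : ℤ) →
    Σ (Fin n) (λ u → (inNA G u ≡ true) × (t ≡ + k - + degA G u)) →
    ((u : Fin n) → inNA G u ≡ true → t ≤ℤ + k - + degA G u) →
    + 2 * + n ≤ℤ + k * + k +ℤ (+ 10 * t +ℤ + 5) * + k +ℤ (+ 25 * t * t +ℤ + 7 * t) +ℤ + 2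
-- `bound` is applied at the vertex attaining the minimum. Matching on the two equations puts `k`
-- and `t` in the form `d + t′` and `+ t′` of that lemma.
theorem3p4 n G simple saturated k k≡ _ t (u , u∈NA , t≡) _
  with Counting.bound G simple saturated u∈NA
... | t′ , k≡d+t′ , 2n≤
  with refl ← trans (sym k≡) k≡d+t′
  with refl ← trans t≡ ([d+t]-d≡t (degA G u) t′) =
  subst₂ _≤ℤ_ (Int.pos-* 2 n) (pos-bound (degA G u + t′) t′) (Int.+≤+ 2n≤)
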